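{- Let $r\ge 1$, $N\ge 1$ and $n\ge 1$ be integers, and for an integer $e\ge 0$ let $$M_r(e)=\sum_{\substack{i_1+\cdots+i_r=e\\ i_1,\dots,i_r\ge 0}}\frac{(N!)^r}{(N+i_1)!\cdots(N+i_r)!}.$$ Then $$B_{N,n}^{(r)}=(-1)^n\,n!\,\det\big(c_{ij}\big)_{1\le i,j\le n},$$ where $c_{ij}=M_r(i-j+1)$ if $j\le i$, $c_{ij}=1$ if $j=i+1$, and $c_{ij}=0$ if $j>i+1$.
   Context: For positive integers $N$ and $r$, the higher order hypergeometric Bernoulli numbers $B^{(r)}_{N,n}$ ($n\ge0$) are defined by $$\left(\frac{x^N/N!}{e^x-\sum_{n=0}^{N-1}x^n/n!}\right)^r=\sum_{n=0}^\infty B_{N,n}^{(r)}\frac{x^n}{n!}.$$ -}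

module Defs where

open import Data.Bool.Base using (if_then_else_; true; false; T)
open import Data.Fin.Base using (Fin; zero; suc; toℕ; punchIn)
import Data.Integer.Base as ℤ
open import Data.List.Base as List using (List; []; _∷_; concatMap; upTo)
open import Data.List.Membership.Propositional using (_∈_; find; lose)
open import Data.List.Membership.Propositional.Properties
  using (∈-map⁺; ∈-map⁻; ∈-concatMap⁺; ∈-concatMap⁻; ∈-upTo⁺; ∈-upTo⁻)
open import Data.List.Relation.Binary.Disjoint.Propositional using (Disjoint)
import Data.List.Relation.Unary.All as All
import Data.List.Relation.Unary.All.Properties as All
open import Data.List.Relation.Unary.AllPairs as AllPairs using ([]; _∷_)
import Data.List.Relation.Unary.AllPairs.Properties as AllPairs
open import Data.List.Relation.Unary.Any using (here)
open import Data.List.Relation.Unary.Unique.Propositional using (Unique)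
import Data.List.Relation.Unary.Unique.Propositional.Properties as Unique
open import Data.Nat.Base as ℕ using (ℕ; zero; suc; _∸_; _!; _<ᵇ_; _≡ᵇ_)
open import Data.Nat.ListAction using (product)
open import Data.Nat.ListAction.Properties using (product≢0)
import Data.Nat.Properties as ℕ
open import Data.Product.Base using (_,_)
open import Data.Rational.Base
  using (ℚ; 0ℚ; 1ℚ; _+_; _*_; _-_; -_; _÷_; 1/_; _/_; NonZero; Positive; +-*-rawSemiring)
open import Data.Rational.Properties
open import Data.Rational.Unnormalised.Base as ℚᵘ using (mkℚᵘ; *≡*)
import Data.Rational.Unnormalised.Properties as ℚᵘ
open import Data.Vec.Base as Vec using (Vec; []; _∷_; toList)
open import Data.Vec.Properties using (∷-injectiveˡ; ∷-injectiveʳ)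
open import Relation.Nullary.Decidable.Core using (yes; no)
open import Relation.Binary.PropositionalEquality

open import Algebra.Definitions.RawSemiring +-*-rawSemiring public using (sum; _^_)

open ≡-Reasoning

fromℕ : ℕ → ℚ
fromℕ m = ℤ.+ m / 1

invFact : ℕ → ℚ
invFact k = (ℤ.+ 1 / k !) {{k ℕ.!≢0}}

invFact-positive : ∀ k → Positive (invFact k)
invFact-positive k = normalize-pos 1 (k !) {{k ℕ.!≢0}}

-- f stands for Σₖ f(k) xᵏ.
Series : Set
Series = ℕ → ℚ

infixl 7 _⊛_
infixl 6 _⊖_
infixr 8 _^ˢ_

_⊖_ : Series → Series → Series
(f ⊖ g) k = f k - g k

_⊛_ : Series → Series → Series
(f ⊛ g) k = sum {suc k} λ i → f (toℕ i) * g (k ∸ toℕ i)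

monomial : ℚ → ℕ → Series
monomial a m k = if k ≡ᵇ m then a else 0ℚ

_^ˢ_ : Series → ℕ → Series
f ^ˢ zero  = monomial 1ℚ 0
f ^ˢ suc r = f ⊛ (f ^ˢ r)

-- Σ_{k<m} f(k) xᵏ
truncate : ℕ → Series → Series
truncate m f k = if k <ᵇ m then f k else 0ℚ

-- f / xᵐ, when xᵐ divides f
shift : ℕ → Series → Series
shift m f k = f (m ℕ.+ k)

-- Long division by a series with nonzero constant term: the leading
-- coefficient of f / g is q = f(0)/g(0), and the others are those of
-- ((f - q g)/x) / g.
divide : (f g : Series) .{{_ : NonZero (g 0)}} → Series
divide f g zero    = f 0 ÷ g 0
divide f g (suc k) = divide (shift 1 (λ j → f j - (f 0 ÷ g 0) * g j)) g k

-- f / g, when g has order m and xᵐ divides f; see quotient-⊛.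
quotient : (m : ℕ) (f g : Series) .{{_ : NonZero (shift m g 0)}} → Series
quotient m f g = divide (shift m f) (shift m g)

divide-⊛ : ∀ f g .{{_ : NonZero (g 0)}} → divide f g ⊛ g ≗ f
divide-⊛ f g zero = begin
  f 0 * 1/ g 0 * g 0 + 0ℚ    ≡⟨ +-identityʳ _ ⟩
  f 0 * 1/ g 0 * g 0         ≡⟨ *-assoc (f 0) (1/ g 0) (g 0) ⟩
  f 0 * (1/ g 0 * g 0)       ≡⟨ cong (f 0 *_) (*-inverseˡ (g 0)) ⟩
  f 0 * 1ℚ                   ≡⟨ *-identityʳ (f 0) ⟩
  f 0                        ∎
divide-⊛ f g (suc k) = begin
  q * g (suc k) + (divide f′ g ⊛ g) k          ≡⟨ cong (q * g (suc k) +_) (divide-⊛ f′ g k) ⟩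
  q * g (suc k) + (f (suc k) - q * g (suc k))  ≡⟨ +-comm (q * g (suc k)) _ ⟩
  f (suc k) - q * g (suc k) + q * g (suc k)    ≡⟨ +-assoc (f (suc k)) (- (q * g (suc k))) _ ⟩
  f (suc k) + (- (q * g (suc k)) + q * g (suc k))
    ≡⟨ cong (f (suc k) +_) (+-inverseˡ (q * g (suc k))) ⟩
  f (suc k) + 0ℚ                               ≡⟨ +-identityʳ _ ⟩
  f (suc k)                                    ∎
  where
  q  = f 0 ÷ g 0
  f′ = shift 1 (λ j → f j - q * g j)

⊛-shift : ∀ h g → g 0 ≡ 0ℚ → ∀ k → (h ⊛ g) (suc k) ≡ (h ⊛ shift 1 g) k
⊛-shift h g g₀ zero = cong (h 0 * g 1 +_) (begin
  h 1 * g 0 + 0ℚ  ≡⟨ +-identityʳ _ ⟩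
  h 1 * g 0       ≡⟨ cong (h 1 *_) g₀ ⟩
  h 1 * 0ℚ        ≡⟨ *-zeroʳ (h 1) ⟩
  0ℚ              ∎)
⊛-shift h g g₀ (suc k) = cong (h 0 * g (suc (suc k)) +_) (⊛-shift (shift 1 h) g g₀ k)

quotient-⊛ : ∀ m f g .{{_ : NonZero (shift m g 0)}} →
             (∀ {k} → k ℕ.< m → f k ≡ 0ℚ) → (∀ {k} → k ℕ.< m → g k ≡ 0ℚ) →
             quotient m f g ⊛ g ≗ f
quotient-⊛ zero    f g f₀ g₀ k = divide-⊛ f g k
quotient-⊛ (suc m) f g f₀ g₀ zero = begin
  h 0 * g 0 + 0ℚ  ≡⟨ +-identityʳ _ ⟩
  h 0 * g 0       ≡⟨ cong (h 0 *_) (g₀ ℕ.z<s) ⟩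
  h 0 * 0ℚ        ≡⟨ *-zeroʳ (h 0) ⟩
  0ℚ              ≡⟨ f₀ ℕ.z<s ⟨
  f 0             ∎
  where h = quotient (suc m) f g
quotient-⊛ (suc m) f g f₀ g₀ (suc k) = begin
  (quotient (suc m) f g ⊛ g) (suc k)      ≡⟨ ⊛-shift (quotient (suc m) f g) g (g₀ ℕ.z<s) k ⟩
  (quotient m (shift 1 f) (shift 1 g) ⊛ shift 1 g) k
    ≡⟨ quotient-⊛ m (shift 1 f) (shift 1 g) (λ k<m → f₀ (ℕ.s<s k<m)) (λ k<m → g₀ (ℕ.s<s k<m)) k ⟩
  f (suc k)                               ∎

expˢ : Series
expˢ = invFact

numerator : ℕ → Series
numerator N = monomial (invFact N) N

denominator : ℕ → Series
denominator N = expˢ ⊖ truncate N expˢ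

denominator-≥ : ∀ N k → denominator N (N ℕ.+ k) ≡ invFact (N ℕ.+ k)
denominator-≥ N k with (N ℕ.+ k) <ᵇ N in eq
... | true  with () ← ℕ.<⇒≱ (ℕ.<ᵇ⇒< (N ℕ.+ k) N (subst T (sym eq) _)) (ℕ.m≤m+n N k)
... | false = +-identityʳ _

denominator-< : ∀ N {k} → k ℕ.< N → denominator N k ≡ 0ℚ
denominator-< N {k} k<N with k <ᵇ N | ℕ.<⇒<ᵇ k<N
... | true | _ = +-inverseʳ (invFact k)

numerator-< : ∀ N {k} → k ℕ.< N → numerator N k ≡ 0ℚ
numerator-< N {k} k<N with k ≡ᵇ N in eq
... | true  with () ← ℕ.<⇒≢ k<N (ℕ.≡ᵇ⇒≡ k N (subst T (sym eq) _))
... | false = refl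

denominator-nonZero : ∀ N → NonZero (shift N (denominator N) 0)
denominator-nonZero N = subst NonZero (sym (denominator-≥ N 0))
  (pos⇒nonZero (invFact (N ℕ.+ 0)) {{invFact-positive (N ℕ.+ 0)}})

-- (xᴺ/N!) / (eˣ - Σ_{n<N} xⁿ/n!)
baseSeries : ℕ → Series
baseSeries N = quotient N (numerator N) (denominator N) {{denominator-nonZero N}}

baseSeries-spec : ∀ N → baseSeries N ⊛ denominator N ≗ numerator N
baseSeries-spec N = quotient-⊛ N (numerator N) (denominator N) {{denominator-nonZero N}}
  (numerator-< N) (denominator-< N)

-- B r N n is B_{N,n}^{(r)}.
B : (r N n : ℕ) → ℚ
B r N n = fromℕ (n !) * (baseSeries N ^ˢ r) n

fromℕ-1/ : ∀ m .{{_ : ℕ.NonZero m}} → fromℕ m * (ℤ.+ 1 / m) ≡ 1ℚ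
fromℕ-1/ m@(suc k) = toℚᵘ-injective
  (ℚᵘ.≃-trans (toℚᵘ-homo-* (fromℕ m) (ℤ.+ 1 / m))
  (ℚᵘ.≃-trans (ℚᵘ.*-cong (toℚᵘ-fromℚᵘ (mkℚᵘ (ℤ.+ m) 0)) (toℚᵘ-fromℚᵘ (mkℚᵘ (ℤ.+ 1) k)))
  (*≡* (cong ℤ.+[1+_] eq))))
  where
  eq : k ℕ.* 1 ℕ.* 1 ≡ k ℕ.+ 0 ℕ.+ 0
  eq = trans (trans (ℕ.*-identityʳ _) (ℕ.*-identityʳ k))
             (sym (trans (ℕ.+-identityʳ _) (ℕ.+-identityʳ k)))

fromℕ-invFact : ∀ n → fromℕ (n !) * invFact n ≡ 1ℚ
fromℕ-invFact n = fromℕ-1/ (n !) {{n ℕ.!≢0}}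

B-spec : ∀ r N n → B r N n * invFact n ≡ (baseSeries N ^ˢ r) n
B-spec r N n = begin
  fromℕ (n !) * b * invFact n    ≡⟨ cong (_* invFact n) (*-comm (fromℕ (n !)) b) ⟩
  b * fromℕ (n !) * invFact n    ≡⟨ *-assoc b (fromℕ (n !)) (invFact n) ⟩
  b * (fromℕ (n !) * invFact n)  ≡⟨ cong (b *_) (fromℕ-invFact n) ⟩
  b * 1ℚ                         ≡⟨ *-identityʳ b ⟩
  b                              ∎
  where b = (baseSeries N ^ˢ r) n

-- All (i₁, …, iᵣ) ∈ ℕʳ with i₁ + ⋯ + iᵣ = e, each listed once.
tuples : (r e : ℕ) → List (Vec ℕ r)
tuples zero    zero    = [] ∷ []
tuples zero    (suc _) = []
tuples (suc r) e       = concatMap (λ i → List.map (i ∷_) (tuples r (e ∸ i))) (upTo (suc e))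

∈-tuples⁺ : ∀ {r} (v : Vec ℕ r) → v ∈ tuples r (Vec.sum v)
∈-tuples⁺ []      = here refl
∈-tuples⁺ (i ∷ v) = ∈-concatMap⁺ _ (lose (∈-upTo⁺ (ℕ.s≤s (ℕ.m≤m+n i (Vec.sum v))))
  (∈-map⁺ (i ∷_) (subst (λ e → v ∈ tuples _ e) (sym (ℕ.m+n∸m≡n i (Vec.sum v))) (∈-tuples⁺ v))))

∈-tuples⁻ : ∀ {r e} {v : Vec ℕ r} → v ∈ tuples r e → Vec.sum v ≡ e
∈-tuples⁻ {zero}  {zero} (here refl) = refl
∈-tuples⁻ {suc r} {e} v∈
  with i , i∈ , v∈′ ← find (∈-concatMap⁻ _ {xs = upTo (suc e)} v∈)
  with w , w∈ , refl ← ∈-map⁻ (i ∷_) v∈′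
  = trans (cong (i ℕ.+_) (∈-tuples⁻ {r} w∈)) (ℕ.m+[n∸m]≡n (ℕ.s≤s⁻¹ (∈-upTo⁻ i∈)))

tuples-unique : ∀ r e → Unique (tuples r e)
tuples-unique zero    zero    = All.[] ∷ []
tuples-unique zero    (suc e) = []
tuples-unique (suc r) e       = Unique.concat⁺
  (All.map⁺ (All.universal (λ i → Unique.map⁺ ∷-injectiveʳ (tuples-unique r (e ∸ i))) (upTo (suc e))))
  (AllPairs.map⁺ (AllPairs.map disjoint (Unique.upTo⁺ (suc e))))
  where
  disjoint : ∀ {i j} → i ≢ j →
             Disjoint (List.map (i ∷_) (tuples r (e ∸ i))) (List.map (j ∷_) (tuples r (e ∸ j)))
  disjoint {i} {j} i≢j (v∈ᵢ , v∈ⱼ)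
    with _ , _ , refl ← ∈-map⁻ (i ∷_) v∈ᵢ
    with _ , _ , eq ← ∈-map⁻ (j ∷_) v∈ⱼ = i≢j (∷-injectiveˡ eq)

-- (N+i₁)! ⋯ (N+iᵣ)!
factorials : ∀ {r} → ℕ → Vec ℕ r → ℕ
factorials N v = product (List.map (λ i → (N ℕ.+ i) !) (toList v))

factorials-nonZero : ∀ {r} N (v : Vec ℕ r) → ℕ.NonZero (factorials N v)
factorials-nonZero N v =
  product≢0 (All.map⁺ (All.universal (λ i → (N ℕ.+ i) ℕ.!≢0) (toList v)))

M : (r N e : ℕ) → ℚ
M r N e = List.foldr _+_ 0ℚ (List.map term (tuples r e))
  where
  term : Vec ℕ r → ℚ
  term v = (ℤ.+ ((N !) ℕ.^ r) / factorials N v) {{factorials-nonZero N v}}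

Matrix : ℕ → Set
Matrix n = Fin n → Fin n → ℚ

-- Laplace expansion along the first row.
det : ∀ {n} → Matrix n → ℚ
det {zero}  A = 1ℚ
det {suc n} A = sum λ j →
  (- 1ℚ) ^ toℕ j * A zero j * det (λ i k → A (suc i) (punchIn j k))

-- Indices start at 0; the entries depend only on i - j.
c : (r N n : ℕ) → Matrix n
c r N n i j with toℕ j ℕ.≤? toℕ i | toℕ j ℕ.≟ suc (toℕ i)
... | yes _ | _     = M r N (suc (toℕ i ∸ toℕ j))
... | no _  | yes _ = 1ℚ
... | no _  | no _  = 0ℚ

{-# OPTIONS --safe #-}

-- Put φ = Σᵢ N!/(N+i)! xⁱ. The base series is the inverse of φ, and M r N is
-- φʳ, so B_{N,n}^{(r)}/n! is the n-th coefficient of the inverse of M r N.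
-- On the other side, for a series a with constant term 1, expanding
-- det (a (i-j+1))_{i,j<n} along its first row shows that the signed
-- determinants are the coefficients of the inverse of a.
module Submission where

open import Defs
open import Algebra.Bundles using (CommutativeMonoid)
import Algebra.Properties.CommutativeSemigroup as CommutativeSemigroup
open import Algebra.Structures using (IsCommutativeMonoid)
import Algebra.Properties.Monoid.Sum as Sum
open import Data.Fin.Base using (Fin; zero; suc; toℕ; punchIn)
import Data.Integer.Base as ℤ
import Data.Integer.Properties as ℤ
open import Data.List.Base as List using (List; []; _∷_; _++_; concatMap; applyUpTo)
open import Data.List.Properties using (map-++; map-∘; map-cong)
open import Data.Nat.Base as ℕ using (ℕ; zero; suc; _≤_; _!; _∸_)
import Data.Nat.Properties as ℕ
open import Data.Product.Base using (_,_)
open import Data.Rational.Base using (ℚ; 0ℚ; 1ℚ; -_; _+_; _*_; _/_)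
open import Data.Rational.Properties
open import Data.Rational.Solver using (module +-*-Solver)
open import Data.Rational.Unnormalised.Base using (mkℚᵘ)
import Data.Rational.Unnormalised.Properties as ℚᵘ
open import Data.Vec.Base using (Vec; []; _∷_)
open import Function.Base using (_∘_; id)
open import Level using (0ℓ)
open import Relation.Binary.PropositionalEquality
open import Relation.Nullary.Decidable.Core using (yes; no)

open Sum +-0-monoid using (sum-cong-≗; sum-replicate-zero)
open +-*-Solver using (solve; con; _:=_; _:+_; _:*_; :-_)
open ≡-Reasoning

private
  1ˢ : Series
  1ˢ = monomial 1ℚ 0

-- The ring of power series

⊛-cong : ∀ {f f′ g g′} → f ≗ f′ → g ≗ g′ → f ⊛ g ≗ f′ ⊛ g′
⊛-cong f≗ g≗ k = sum-cong-≗ {suc k} λ i → cong₂ _*_ (f≗ (toℕ i)) (g≗ (k ∸ toℕ i))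

-- By computation `(f ⊛ g) (suc k)` is `f 0 * g (suc k) + (shift 1 f ⊛ g) k`, so product identities
-- follow by induction on the index with the left factor shifted.
⊛-scaleˡ : ∀ a f g → (λ k → a * f k) ⊛ g ≗ λ k → a * (f ⊛ g) k
⊛-scaleˡ a f g zero    =
  solve 3 (λ a x y → a :* x :* y :+ con 0ℚ := a :* (x :* y :+ con 0ℚ)) refl a (f 0) (g 0)
⊛-scaleˡ a f g (suc k) = begin
  a * f 0 * g (suc k) + ((λ k → a * shift 1 f k) ⊛ g) k
    ≡⟨ cong (a * f 0 * g (suc k) +_) (⊛-scaleˡ a (shift 1 f) g k) ⟩
  a * f 0 * g (suc k) + a * (shift 1 f ⊛ g) k
    ≡⟨ solve 4 (λ a x y z → a :* x :* y :+ a :* z := a :* (x :* y :+ z)) refl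
         a (f 0) (g (suc k)) ((shift 1 f ⊛ g) k) ⟩
  a * (f 0 * g (suc k) + (shift 1 f ⊛ g) k)  ∎

⊛-distribʳ-+ : ∀ f g h → (λ k → f k + g k) ⊛ h ≗ λ k → (f ⊛ h) k + (g ⊛ h) k
⊛-distribʳ-+ f g h zero =
  solve 3 (λ x y z → (x :+ y) :* z :+ con 0ℚ := x :* z :+ con 0ℚ :+ (y :* z :+ con 0ℚ)) refl
    (f 0) (g 0) (h 0)
⊛-distribʳ-+ f g h (suc k) = begin
  (f 0 + g 0) * h (suc k) + ((λ k → shift 1 f k + shift 1 g k) ⊛ h) k
    ≡⟨ cong ((f 0 + g 0) * h (suc k) +_) (⊛-distribʳ-+ (shift 1 f) (shift 1 g) h k) ⟩
  (f 0 + g 0) * h (suc k) + ((shift 1 f ⊛ h) k + (shift 1 g ⊛ h) k)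
    ≡⟨ solve 5 (λ x y z u v → (x :+ y) :* z :+ (u :+ v) := x :* z :+ u :+ (y :* z :+ v)) refl
         (f 0) (g 0) (h (suc k)) ((shift 1 f ⊛ h) k) ((shift 1 g ⊛ h) k) ⟩
  (f ⊛ h) (suc k) + (g ⊛ h) (suc k)  ∎

⊛-assoc : ∀ f g h → (f ⊛ g) ⊛ h ≗ f ⊛ (g ⊛ h)
⊛-assoc f g h zero =
  solve 3 (λ x y z → (x :* y :+ con 0ℚ) :* z :+ con 0ℚ := x :* (y :* z :+ con 0ℚ) :+ con 0ℚ) refl
    (f 0) (g 0) (h 0)
⊛-assoc f g h (suc k) = begin
  -- The series in the second summand is `shift 1 (f ⊛ g)`, unfolded.
  (f ⊛ g) 0 * h (suc k) + ((λ j → f 0 * shift 1 g j + (shift 1 f ⊛ g) j) ⊛ h) k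
    ≡⟨ cong ((f ⊛ g) 0 * h (suc k) +_) (begin
      ((λ j → f 0 * shift 1 g j + (shift 1 f ⊛ g) j) ⊛ h) k
        ≡⟨ ⊛-distribʳ-+ (λ j → f 0 * shift 1 g j) (shift 1 f ⊛ g) h k ⟩
      ((λ j → f 0 * shift 1 g j) ⊛ h) k + ((shift 1 f ⊛ g) ⊛ h) k
        ≡⟨ cong₂ _+_ (⊛-scaleˡ (f 0) (shift 1 g) h k) (⊛-assoc (shift 1 f) g h k) ⟩
      f 0 * (shift 1 g ⊛ h) k + (shift 1 f ⊛ (g ⊛ h)) k  ∎) ⟩
  (f 0 * g 0 + 0ℚ) * h (suc k) + (f 0 * (shift 1 g ⊛ h) k + (shift 1 f ⊛ (g ⊛ h)) k)
    ≡⟨ solve 5 (λ x y z u v → (x :* y :+ con 0ℚ) :* z :+ (x :* u :+ v) := x :* (y :* z :+ u) :+ v)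
         refl (f 0) (g 0) (h (suc k)) ((shift 1 g ⊛ h) k) ((shift 1 f ⊛ (g ⊛ h)) k) ⟩
  f 0 * (g 0 * h (suc k) + (shift 1 g ⊛ h) k) + (shift 1 f ⊛ (g ⊛ h)) k  ∎

-- Mirror image of the computational unfolding: it splits off the last summand instead of the first,
-- which is what commutativity requires.
⊛-unfoldʳ : ∀ f g k → (f ⊛ g) (suc k) ≡ g 0 * f (suc k) + (f ⊛ shift 1 g) k
⊛-unfoldʳ f g zero =
  solve 4 (λ x y z w → x :* y :+ (z :* w :+ con 0ℚ) := w :* z :+ (x :* y :+ con 0ℚ)) refl
    (f 0) (g 1) (f 1) (g 0)
⊛-unfoldʳ f g (suc k) = begin
  f 0 * g (2 ℕ.+ k) + (shift 1 f ⊛ g) (suc k)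
    ≡⟨ cong (f 0 * g (2 ℕ.+ k) +_) (⊛-unfoldʳ (shift 1 f) g k) ⟩
  f 0 * g (2 ℕ.+ k) + (g 0 * f (2 ℕ.+ k) + (shift 1 f ⊛ shift 1 g) k)
    ≡⟨ solve 3 (λ x y z → x :+ (y :+ z) := y :+ (x :+ z)) refl
         (f 0 * g (2 ℕ.+ k)) (g 0 * f (2 ℕ.+ k)) ((shift 1 f ⊛ shift 1 g) k) ⟩
  g 0 * f (2 ℕ.+ k) + (f ⊛ shift 1 g) (suc k)  ∎

⊛-comm : ∀ f g → f ⊛ g ≗ g ⊛ f
⊛-comm f g zero    = cong (_+ 0ℚ) (*-comm (f 0) (g 0))
⊛-comm f g (suc k) = begin
  f 0 * g (suc k) + (shift 1 f ⊛ g) k  ≡⟨ cong (f 0 * g (suc k) +_) (⊛-comm (shift 1 f) g k) ⟩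
  f 0 * g (suc k) + (g ⊛ shift 1 f) k  ≡⟨ ⊛-unfoldʳ g f k ⟨
  (g ⊛ f) (suc k)                      ∎

⊛-zeroˡ : ∀ g → (λ _ → 0ℚ) ⊛ g ≗ λ _ → 0ℚ
-- Since `0ℚ * 0ℚ` computes to `0ℚ`, the zero series is `0ℚ` times itself.
⊛-zeroˡ g k = trans (⊛-scaleˡ 0ℚ (λ _ → 0ℚ) g k) (*-zeroˡ (((λ _ → 0ℚ) ⊛ g) k))

⊛-identityˡ : ∀ g → 1ˢ ⊛ g ≗ g
⊛-identityˡ g zero    = trans (+-identityʳ _) (*-identityˡ (g 0))
⊛-identityˡ g (suc k) = begin
  1ℚ * g (suc k) + ((λ _ → 0ℚ) ⊛ g) k  ≡⟨ cong₂ _+_ (*-identityˡ (g (suc k))) (⊛-zeroˡ g k) ⟩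
  g (suc k) + 0ℚ                       ≡⟨ +-identityʳ _ ⟩
  g (suc k)                            ∎

⊛-identityʳ : ∀ g → g ⊛ 1ˢ ≗ g
⊛-identityʳ g k = trans (⊛-comm g 1ˢ k) (⊛-identityˡ g k)

⊛-isCommutativeMonoid : IsCommutativeMonoid _≗_ _⊛_ 1ˢ
⊛-isCommutativeMonoid = record
  { isMonoid = record
    { isSemigroup = record
      { isMagma = record
        { isEquivalence = record
          { refl  = λ _ → refl
          ; sym   = λ p k → sym (p k)
          ; trans = λ p q k → trans (p k) (q k)
          }
        ; ∙-cong = ⊛-cong
        }
      ; assoc = ⊛-assoc
      }
    ; identity = ⊛-identityˡ , ⊛-identityʳ
    }
  ; comm = ⊛-comm
  }

⊛-commutativeMonoid : CommutativeMonoid 0ℓ 0ℓ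
⊛-commutativeMonoid = record { isCommutativeMonoid = ⊛-isCommutativeMonoid }

open CommutativeSemigroup (CommutativeMonoid.commutativeSemigroup ⊛-commutativeMonoid)
  using () renaming (interchange to ⊛-interchange)

-- Inverses of power series

^ˢ-inverse : ∀ {f g} r → f ⊛ g ≗ 1ˢ → f ^ˢ r ⊛ g ^ˢ r ≗ 1ˢ
^ˢ-inverse zero    f⊛g = ⊛-identityˡ 1ˢ
^ˢ-inverse {f} {g} (suc r) f⊛g k = begin
  ((f ⊛ f ^ˢ r) ⊛ (g ⊛ g ^ˢ r)) k  ≡⟨ ⊛-interchange f (f ^ˢ r) g (g ^ˢ r) k ⟩
  ((f ⊛ g) ⊛ (f ^ˢ r ⊛ g ^ˢ r)) k  ≡⟨ ⊛-cong f⊛g (^ˢ-inverse r f⊛g) k ⟩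
  (1ˢ ⊛ 1ˢ) k                      ≡⟨ ⊛-identityˡ 1ˢ k ⟩
  1ˢ k                             ∎

inverse-unique : ∀ {f g h} → f ⊛ g ≗ 1ˢ → g ⊛ h ≗ 1ˢ → f ≗ h
inverse-unique {f} {g} {h} f⊛g g⊛h k = begin
  f k              ≡⟨ ⊛-identityʳ f k ⟨
  (f ⊛ 1ˢ) k       ≡⟨ ⊛-cong {f} (λ _ → refl) g⊛h k ⟨
  (f ⊛ (g ⊛ h)) k  ≡⟨ ⊛-assoc f g h k ⟨
  ((f ⊛ g) ⊛ h) k  ≡⟨ ⊛-cong {g = h} f⊛g (λ _ → refl) k ⟩
  (1ˢ ⊛ h) k       ≡⟨ ⊛-identityˡ h k ⟩
  h k              ∎

-- Inverting the base series

-- The series φ, that is, the exponential tail divided by xᴺ/N!.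
reciprocal : ℕ → Series
reciprocal N i = fromℕ (N !) * invFact (N ℕ.+ i)

shift-numerator : ∀ N k → shift N (numerator N) k ≡ monomial (invFact N) 0 k
shift-numerator N k = go N k
  where
  go : ∀ m k → monomial (invFact N) m (m ℕ.+ k) ≡ monomial (invFact N) 0 k
  go zero    k = refl
  go (suc m) k = go m k

-- Once xᴺ is cancelled, `baseSeries N` is a long division of the constant 1/N! by the shifted
-- exponential, so `divide-⊛` applies; the factor N! then turns 1/N! into 1.
reciprocal-⊛-baseSeries : ∀ N → reciprocal N ⊛ baseSeries N ≗ 1ˢ
reciprocal-⊛-baseSeries N k = begin
  (reciprocal N ⊛ baseSeries N) k
    ≡⟨ ⊛-scaleˡ (fromℕ (N !)) (shift N invFact) (baseSeries N) k ⟩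
  fromℕ (N !) * (shift N invFact ⊛ baseSeries N) k
    ≡⟨ cong (fromℕ (N !) *_) (⊛-cong {g = baseSeries N} (denominator-≥ N) (λ _ → refl) k) ⟨
  fromℕ (N !) * (shift N (denominator N) ⊛ baseSeries N) k
    ≡⟨ cong (fromℕ (N !) *_) (⊛-comm (shift N (denominator N)) (baseSeries N) k) ⟩
  fromℕ (N !) * (baseSeries N ⊛ shift N (denominator N)) k
    ≡⟨ cong (fromℕ (N !) *_)
         (divide-⊛ (shift N (numerator N)) (shift N (denominator N)) {{denominator-nonZero N}} k) ⟩
  fromℕ (N !) * shift N (numerator N) k
    ≡⟨ cong (fromℕ (N !) *_) (shift-numerator N k) ⟩
  fromℕ (N !) * monomial (invFact N) 0 k
    ≡⟨ normalise k ⟩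
  1ˢ k  ∎
  where
  normalise : ∀ k → fromℕ (N !) * monomial (invFact N) 0 k ≡ 1ˢ k
  normalise zero    = fromℕ-invFact N
  normalise (suc k) = *-zeroʳ (fromℕ (N !))

-- Sums over tuples

-- Unnormalised fractions multiply componentwise, so the detour through them avoids reasoning about
-- gcds.
/-*-/ : ∀ p q m n .{{_ : ℕ.NonZero m}} .{{_ : ℕ.NonZero n}} .{{_ : ℕ.NonZero (m ℕ.* n)}} →
        (p / m) * (q / n) ≡ (p ℤ.* q) / (m ℕ.* n)
/-*-/ p q m@(suc m-1) n@(suc n-1) = toℚᵘ-injective
  (ℚᵘ.≃-trans (toℚᵘ-homo-* (p / m) (q / n))
  (ℚᵘ.≃-trans (ℚᵘ.*-cong (toℚᵘ-fromℚᵘ (mkℚᵘ p m-1)) (toℚᵘ-fromℚᵘ (mkℚᵘ q n-1)))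
  (ℚᵘ.≃-sym (toℚᵘ-fromℚᵘ (mkℚᵘ (p ℤ.* q) (n-1 ℕ.+ m-1 ℕ.* n))))))

-- Agrees by computation with the local summand in `M`, which it makes available to lemmas.
term : ∀ {r} → ℕ → Vec ℕ r → ℚ
term {r} N v = (ℤ.+ ((N !) ℕ.^ r) / factorials N v) {{factorials-nonZero N v}}

term-∷ : ∀ {r} N i (v : Vec ℕ r) → term N (i ∷ v) ≡ reciprocal N i * term N v
term-∷ {r} N i v = sym (begin
  fromℕ (N !) * invFact (N ℕ.+ i) * term N v
    -- `fromℕ (N !)` is a fraction over 1, hence the denominator `1 * F`.
    ≡⟨ cong (_* term N v) (/-*-/ (ℤ.+ (N !)) (ℤ.+ 1) 1 F {{_}} {{F≢0}} {{1*F≢0}}) ⟩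
  ((ℤ.+ (N !) ℤ.* ℤ.+ 1) / (1 ℕ.* F)) {{1*F≢0}} * term N v
    ≡⟨ cong (_* term N v)
         (/-cong {{1*F≢0}} {{F≢0}} (ℤ.*-identityʳ (ℤ.+ (N !))) (ℕ.*-identityˡ F)) ⟩
  (ℤ.+ (N !) / F) {{F≢0}} * term N v
    ≡⟨ /-*-/ (ℤ.+ (N !)) (ℤ.+ ((N !) ℕ.^ r)) F (factorials N v)
         {{F≢0}} {{factorials-nonZero N v}} {{factorials-nonZero N (i ∷ v)}} ⟩
  ((ℤ.+ (N !) ℤ.* ℤ.+ ((N !) ℕ.^ r)) / factorials N (i ∷ v)) {{factorials-nonZero N (i ∷ v)}}
    ≡⟨ /-cong {{factorials-nonZero N (i ∷ v)}} {{factorials-nonZero N (i ∷ v)}}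
         (sym (ℤ.pos-* (N !) ((N !) ℕ.^ r))) refl ⟩
  term N (i ∷ v)  ∎)
  where
  F = (N ℕ.+ i) !
  F≢0 : ℕ.NonZero F
  F≢0 = (N ℕ.+ i) ℕ.!≢0
  1*F≢0 : ℕ.NonZero (1 ℕ.* F)
  1*F≢0 = ℕ.m*n≢0 1 F {{_}} {{F≢0}}

sumList : List ℚ → ℚ
sumList = List.foldr _+_ 0ℚ

sumList-++ : ∀ xs ys → sumList (xs ++ ys) ≡ sumList xs + sumList ys
sumList-++ []       ys = sym (+-identityˡ _)
sumList-++ (x ∷ xs) ys =
  trans (cong (x +_) (sumList-++ xs ys)) (sym (+-assoc x (sumList xs) (sumList ys)))

-- The enumeration `h` is arbitrary because the induction replaces it by `h ∘ suc`; `upTo` is the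
-- case `id`.
sumList-concatMap : ∀ {A : Set} (f : A → ℚ) (g : ℕ → List A) h n →
  sumList (List.map f (concatMap g (applyUpTo h n))) ≡
  sum {n} λ i → sumList (List.map f (g (h (toℕ i))))
sumList-concatMap f g h zero    = refl
sumList-concatMap f g h (suc n) = begin
  sumList (List.map f (g (h 0) ++ rest))
    ≡⟨ cong sumList (map-++ f (g (h 0)) rest) ⟩
  sumList (List.map f (g (h 0)) ++ List.map f rest)
    ≡⟨ sumList-++ (List.map f (g (h 0))) (List.map f rest) ⟩
  sumList (List.map f (g (h 0))) + sumList (List.map f rest)
    ≡⟨ cong (sumList (List.map f (g (h 0))) +_) (sumList-concatMap f g (h ∘ suc) n) ⟩
  sum {suc n} (λ i → sumList (List.map f (g (h (toℕ i)))))  ∎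
  where rest = concatMap g (applyUpTo (h ∘ suc) n)

sumList-scale : ∀ {A : Set} a (f : A → ℚ) xs →
  sumList (List.map (λ x → a * f x) xs) ≡ a * sumList (List.map f xs)
sumList-scale a f []       = sym (*-zeroʳ a)
sumList-scale a f (x ∷ xs) = trans (cong (a * f x +_) (sumList-scale a f xs))
  (sym (*-distribˡ-+ a (f x) (sumList (List.map f xs))))

-- Grouping the tuples by their first entry `i` factors `reciprocal N i` out of each group, which
-- leaves a Cauchy product.
M-suc : ∀ r N → M (suc r) N ≗ reciprocal N ⊛ M r N
M-suc r N e = trans (sumList-concatMap (term N) (λ i → List.map (i ∷_) (tuples r (e ∸ i))) id (suc e))
  (sum-cong-≗ {suc e} λ i → block (toℕ i))
  where
  block : ∀ i → sumList (List.map (term N) (List.map (i ∷_) (tuples r (e ∸ i)))) ≡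
                reciprocal N i * M r N (e ∸ i)
  block i = begin
    sumList (List.map (term N) (List.map (i ∷_) vs))
      ≡⟨ cong sumList (map-∘ vs) ⟨
    sumList (List.map (λ v → term N (i ∷ v)) vs)
      ≡⟨ cong sumList (map-cong (term-∷ N i) vs) ⟩
    sumList (List.map (λ v → reciprocal N i * term N v) vs)
      ≡⟨ sumList-scale (reciprocal N i) (term N) vs ⟩
    reciprocal N i * M r N (e ∸ i)  ∎
    where vs = tuples r (e ∸ i)

M≗reciprocal^ : ∀ r N → M r N ≗ reciprocal N ^ˢ r
-- The only summand belongs to the empty tuple and is the empty product 1.
M≗reciprocal^ zero    N zero    = refl
M≗reciprocal^ zero    N (suc e) = refl
M≗reciprocal^ (suc r) N e       =
  trans (M-suc r N e) (⊛-cong {reciprocal N} (λ _ → refl) (M≗reciprocal^ r N) e)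

M-⊛-baseSeries^ : ∀ r N → M r N ⊛ baseSeries N ^ˢ r ≗ 1ˢ
M-⊛-baseSeries^ r N k = trans
  (⊛-cong {g = baseSeries N ^ˢ r} (M≗reciprocal^ r N) (λ _ → refl) k)
  (^ˢ-inverse r (reciprocal-⊛-baseSeries N) k)

-- Supplies both the unit constant term needed to invert `M r N` by determinants and the ones on the
-- superdiagonal of `c`.
M-0 : ∀ r N → M r N 0 ≡ 1ℚ
M-0 r N = trans (M≗reciprocal^ r N 0) (go r)
  where
  go : ∀ r → (reciprocal N ^ˢ r) 0 ≡ 1ℚ
  go zero    = refl
  go (suc r) = begin
    fromℕ (N !) * invFact (N ℕ.+ 0) * (reciprocal N ^ˢ r) 0 + 0ℚ
      ≡⟨ +-identityʳ _ ⟩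
    fromℕ (N !) * invFact (N ℕ.+ 0) * (reciprocal N ^ˢ r) 0
      ≡⟨ cong₂ (λ m x → fromℕ (N !) * invFact m * x) (ℕ.+-identityʳ N) (go r) ⟩
    fromℕ (N !) * invFact N * 1ℚ
      ≡⟨ *-identityʳ _ ⟩
    fromℕ (N !) * invFact N
      ≡⟨ fromℕ-invFact N ⟩
    1ℚ  ∎

-- Hessenberg determinants

det-cong : ∀ {n} {A A′ : Matrix n} → (∀ i j → A i j ≡ A′ i j) → det A ≡ det A′
det-cong {zero}  A≗ = refl
det-cong {suc n} A≗ = sum-cong-≗ {suc n} λ j → cong₂ _*_
  (cong ((- 1ℚ) ^ toℕ j *_) (A≗ zero j))
  (det-cong λ i k → A≗ (suc i) (punchIn j k))

-- Recursion along the diagonal makes deleting the first row and column a computation.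
toeplitz : Series → ℕ → ℕ → ℚ
toeplitz a i       zero    = a i
toeplitz a zero    (suc j) = 0ℚ
toeplitz a (suc i) (suc j) = toeplitz a i j

-- The first column is kept arbitrary so that the family is closed under
-- deleting the first row together with one of the first two columns.
hessenberg : (a b : Series) → ℕ → ℕ → ℚ
hessenberg a b i zero    = b i
hessenberg a b i (suc j) = toeplitz a i j

hessenbergDet : (a b : Series) → ℕ → ℚ
hessenbergDet a b n = det {n} λ i j → hessenberg a b (toℕ i) (toℕ j)

-- The first row is `b 0`, `a 0`, 0, ..., so two minors survive. Deleting column 0 promotes the next
-- Toeplitz column, now starting at `a 1`; deleting column 1 keeps `b`, moved up by one row.
hessenbergDet-expand : ∀ a b n → a 0 ≡ 1ℚ →
  hessenbergDet a b (2 ℕ.+ n) ≡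
  b 0 * hessenbergDet a (shift 1 a) (suc n) + - hessenbergDet a (shift 1 b) (suc n)
hessenbergDet-expand a b n a₀ = begin
  1ℚ * b 0 * D₀ + ((- 1ℚ) * 1ℚ * a 0 * D₁ + sum {n} tail)
    ≡⟨ cong₂ (λ x y → 1ℚ * b 0 * x + y)
         (det-cong minor₀)
         (cong₂ _+_ (cong₂ (λ x y → (- 1ℚ) * 1ℚ * x * y) a₀ (det-cong minor₁)) tail≡0) ⟩
  1ℚ * b 0 * D₀′ + ((- 1ℚ) * 1ℚ * 1ℚ * D₁′ + 0ℚ)
    ≡⟨ solve 3 (λ x y z → con 1ℚ :* x :* y :+ ((:- con 1ℚ) :* con 1ℚ :* con 1ℚ :* z :+ con 0ℚ)
                          := x :* y :+ :- z) refl (b 0) D₀′ D₁′ ⟩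
  b 0 * D₀′ + - D₁′  ∎
  where
  minor : Fin (2 ℕ.+ n) → Matrix (suc n)
  minor j i k = hessenberg a b (suc (toℕ i)) (toℕ (punchIn j k))
  D₀  = det (minor zero)
  D₁  = det (minor (suc zero))
  D₀′ = hessenbergDet a (shift 1 a) (suc n)
  D₁′ = hessenbergDet a (shift 1 b) (suc n)
  tail : Fin n → ℚ
  tail j = (- 1ℚ) ^ (2 ℕ.+ toℕ j) * 0ℚ * det (minor (suc (suc j)))
  tail≡0 : sum {n} tail ≡ 0ℚ
  tail≡0 = trans
    (sum-cong-≗ {n} λ j → trans
      (cong (_* det (minor (suc (suc j)))) (*-zeroʳ ((- 1ℚ) ^ (2 ℕ.+ toℕ j))))
      (*-zeroˡ (det (minor (suc (suc j))))))
    (sum-replicate-zero n)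
  minor₀ : ∀ i k → minor zero i k ≡ hessenberg a (shift 1 a) (toℕ i) (toℕ k)
  minor₀ i zero    = refl
  minor₀ i (suc k) = refl
  minor₁ : ∀ i k → minor (suc zero) i k ≡ hessenberg a (shift 1 b) (toℕ i) (toℕ k)
  minor₁ i zero    = refl
  minor₁ i (suc k) = refl

-- With `shift 1 a` as first column the matrix is the full Toeplitz matrix with entries a(i-j+1).
signedDet : Series → Series
signedDet a n = (- 1ℚ) ^ n * hessenbergDet a (shift 1 a) n

-- Each expansion along the first row emits the summand of the Cauchy product containing `b 0` and
-- replaces `b` by `shift 1 b`; hence `b` must stay general in the induction.
hessenbergDet-⊛ : ∀ a b n → a 0 ≡ 1ℚ →
  (- 1ℚ) ^ suc n * hessenbergDet a b (suc n) ≡ - (b ⊛ signedDet a) n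
hessenbergDet-⊛ a b zero    a₀ =
  solve 1 (λ x → (:- con 1ℚ) :* con 1ℚ :* (con 1ℚ :* x :* con 1ℚ :+ con 0ℚ)
                 := :- (x :* (con 1ℚ :* con 1ℚ) :+ con 0ℚ)) refl (b 0)
hessenbergDet-⊛ a b (suc n) a₀ = begin
  (- 1ℚ) * s * hessenbergDet a b (2 ℕ.+ n)
    ≡⟨ cong ((- 1ℚ) * s *_) (hessenbergDet-expand a b n a₀) ⟩
  (- 1ℚ) * s * (b 0 * D₀ + - D₁)
    ≡⟨ solve 4 (λ s x y z → (:- con 1ℚ) :* s :* (x :* y :+ :- z) := :- (x :* (s :* y)) :+ s :* z)
         refl s (b 0) D₀ D₁ ⟩
  - (b 0 * (s * D₀)) + s * D₁
    ≡⟨ cong (- (b 0 * (s * D₀)) +_) (hessenbergDet-⊛ a (shift 1 b) n a₀) ⟩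
  - (b 0 * (s * D₀)) + - (shift 1 b ⊛ signedDet a) n
    ≡⟨ neg-distrib-+ (b 0 * (s * D₀)) ((shift 1 b ⊛ signedDet a) n) ⟨
  - (b ⊛ signedDet a) (suc n)  ∎
  where
  s  = (- 1ℚ) ^ suc n
  D₀ = hessenbergDet a (shift 1 a) (suc n)
  D₁ = hessenbergDet a (shift 1 b) (suc n)

signedDet-inverse : ∀ a → a 0 ≡ 1ℚ → signedDet a ⊛ a ≗ 1ˢ
signedDet-inverse a a₀ zero    = cong (λ x → 1ℚ * 1ℚ * x + 0ℚ) a₀
signedDet-inverse a a₀ (suc n) = begin
  (signedDet a ⊛ a) (suc n)
    ≡⟨ ⊛-comm (signedDet a) a (suc n) ⟩
  a 0 * signedDet a (suc n) + (shift 1 a ⊛ signedDet a) n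
    -- Taking `b = shift 1 a` turns the leading summand into the negative of the remaining sum.
    ≡⟨ cong₂ (λ x y → x * y + (shift 1 a ⊛ signedDet a) n) a₀ (hessenbergDet-⊛ a (shift 1 a) n a₀) ⟩
  1ℚ * - (shift 1 a ⊛ signedDet a) n + (shift 1 a ⊛ signedDet a) n
    ≡⟨ solve 1 (λ x → con 1ℚ :* (:- x) :+ x := con 0ℚ) refl ((shift 1 a ⊛ signedDet a) n) ⟩
  0ℚ  ∎

-- Matrix entries and the determinant formula

toeplitz-≥ : ∀ a {i j} → j ≤ i → toeplitz a i j ≡ a (i ∸ j)
toeplitz-≥ a {i}     {zero}  _   = refl
toeplitz-≥ a {suc i} {suc j} j≤i = toeplitz-≥ a (ℕ.s≤s⁻¹ j≤i)

toeplitz-< : ∀ a {i j} → i ℕ.< j → toeplitz a i j ≡ 0ℚ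
toeplitz-< a {zero}  {suc j} _   = refl
toeplitz-< a {suc i} {suc j} i<j = toeplitz-< a (ℕ.s≤s⁻¹ i<j)

c≡hessenberg : ∀ r N n i j →
  c r N n i j ≡ hessenberg (M r N) (shift 1 (M r N)) (toℕ i) (toℕ j)
c≡hessenberg r N n i zero = refl
c≡hessenberg r N n i (suc j)
  with suc (toℕ j) ℕ.≤? toℕ i | suc (toℕ j) ℕ.≟ suc (toℕ i)
... | yes j<i | _ = begin
  -- The bound `j<i` keeps the truncated subtraction exact, so the successor can be absorbed.
  M r N (suc (toℕ i ∸ suc (toℕ j)))  ≡⟨ cong (M r N) (ℕ.+-∸-assoc 1 j<i) ⟨
  M r N (toℕ i ∸ toℕ j)              ≡⟨ toeplitz-≥ (M r N) (ℕ.<⇒≤ j<i) ⟨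
  toeplitz (M r N) (toℕ i) (toℕ j)   ∎
... | no j≮i | yes j≡i = begin
  -- On the superdiagonal the prescribed 1 is the constant term of `M r N`.
  1ℚ                                 ≡⟨ M-0 r N ⟨
  M r N 0                            ≡⟨ cong (M r N) (ℕ.n∸n≡0 (toℕ i)) ⟨
  M r N (toℕ i ∸ toℕ i)              ≡⟨ toeplitz-≥ (M r N) (ℕ.≤-refl {toℕ i}) ⟨
  toeplitz (M r N) (toℕ i) (toℕ i)   ≡⟨ cong (toeplitz (M r N) (toℕ i)) (ℕ.suc-injective j≡i) ⟨
  toeplitz (M r N) (toℕ i) (toℕ j)   ∎
... | no j≮i | no j≢i = sym (toeplitz-< (M r N)
  (ℕ.≤∧≢⇒< (ℕ.≮⇒≥ j≮i) (j≢i ∘ cong suc ∘ sym)))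

theorem2 : (r N n : ℕ) → 1 ≤ r → 1 ≤ N → 1 ≤ n →
    B r N n ≡ (- 1ℚ) ^ n * fromℕ (n !) * det (c r N n)
theorem2 r N n _ _ _ = begin
  fromℕ (n !) * (baseSeries N ^ˢ r) n
    -- The signed determinants and `baseSeries N ^ˢ r` are both inverse to `M r N`, hence equal.
    ≡⟨ cong (fromℕ (n !) *_) (inverse-unique {signedDet (M r N)} {M r N} {baseSeries N ^ˢ r}
         (signedDet-inverse (M r N) (M-0 r N)) (M-⊛-baseSeries^ r N) n) ⟨
  fromℕ (n !) * ((- 1ℚ) ^ n * hessenbergDet (M r N) (shift 1 (M r N)) n)
    ≡⟨ cong (λ x → fromℕ (n !) * ((- 1ℚ) ^ n * x)) (det-cong (c≡hessenberg r N n)) ⟨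
  fromℕ (n !) * ((- 1ℚ) ^ n * det (c r N n))
    ≡⟨ solve 3 (λ x y z → x :* (y :* z) := y :* x :* z) refl
         (fromℕ (n !)) ((- 1ℚ) ^ n) (det (c r N n)) ⟩
  (- 1ℚ) ^ n * fromℕ (n !) * det (c r N n)  ∎
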